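{- Let $G$ be an abelian group and let $S \subseteq G$ be a symmetric subset such that $\operatorname{Cay}(G;S)$ is connected. Then the following are equivalent: (1) $\operatorname{Cay}(G;S)$ is CCA. (2) $\operatorname{Cay}(G;S)$ is strongly CCA. (3) $|G : \langle T(S,2s)\rangle| \le 2$ for all $s \in S$ with $|s| = 4$, where $T(S,c) := \{\, t \in S \mid 2t \neq c \,\} \cup \{c\}$.
   Context: Groups are abelian, written additively, and may be infinite; $|s|$ denotes the order of the element $s$, and $\langle X \rangle$ the subgroup generated by $X$. A subset $S$ of an abelian group $G$ is symmetric if $S = -S$. For symmetric $S \subseteq G$, the abelian Cayley graph $\operatorname{Cay}(G;S)$ is the undirected graph whose vertices are the elements of $G$, with an edge joining $g$ and $g+s$ for all $g \in G$ and $s \in S$. (It is connected if and only if $S$ generates $G$.) The edge joining $g$ and $g+s$ is coloured with the set $\{\pm s\}$. An automorphism $\varphi$ of $\operatorname{Cay}(G;S)$ is colour-preserving if $\varphi(g+s) \in \{\varphi(g) \pm s\}$ for all $g \in G$ and $s \in S$. An automorphism $\varphi$ of $\operatorname{Cay}(G;S)$ is colour-permuting if there is a bijection $\pi \colon S \to S$ such that $\varphi(g+s) \in \{\varphi(g) \pm \pi(s)\}$ for all $g \in G$ and $s \in S$. A bijection $\varphi \colon G_1 \to G_2$ between abelian groups is affine if there are a group isomorphism $\tau \colon G_1 \to G_2$ and an element $g_2 \in G_2$ such that $\varphi(x) = \tau(x) + g_2$ for all $x \in G_1$. The graph $\operatorname{Cay}(G;S)$ is CCA if every colour-preserving automorphism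 of it is affine, and strongly CCA if every colour-permuting automorphism of it is affine.
   Formalization: Colour-permuting here also requires that {±s} ↦ {±π(s)} be well defined and injective on colours; this is automatic for finite S, but without it (2) can fail while (1) and (3) hold, e.g. for infinite direct sums of copies of ℤ/2×ℤ/2 and ℤ/4. -}

module Defs where

open import Algebra.Bundles using (AbelianGroup)
open import Algebra.Morphism.Structures using (module GroupMorphisms)
import Algebra.Definitions.RawMonoid as RawMonoidDefinitions
import Algebra.Properties.AbelianGroup as AbelianGroupProperties
open import Data.Fin.Base using (Fin)
open import Data.Nat.Base using (ℕ; _<_; _≤_)
open import Data.Product.Base using (Σ; ∃; _×_; proj₁)
open import Data.Sum.Base using (_⊎_)
open import Function.Bundles using (Bijection; _⇔_)
open import Level using (Level; _⊔_; suc)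
open import Relation.Binary.Bundles using (Setoid)
import Relation.Binary.Construct.On as On
open import Relation.Binary.Core using (Rel)
open import Relation.Binary.Definitions using (_Respects_)
import Relation.Binary.PropositionalEquality.Properties as ≡
open import Relation.Nullary.Negation.Core using (¬_)
open import Relation.Unary using (Pred; _∈_; _≐_; _∪_)

-- The equality of a group is its setoid equality _≈_ throughout: subsets are
-- predicates respecting _≈_, and bijections are bijections of setoids.

module GroupNotions {c ℓ} (G : AbelianGroup c ℓ) where

  open AbelianGroup G using (Carrier; _≈_; setoid; rawMonoid; inverseˡ; inverseʳ; assoc; identityˡ; ∙-congˡ; ∙-congʳ; _-_)
    renaming (_∙_ to _+_; ε to 0#; _⁻¹ to -_)
  open AbelianGroupProperties G using (⁻¹-anti-homo‿-)
  open RawMonoidDefinitions rawMonoid public using () renaming (_×_ to _·_)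
  private module S = Setoid setoid

  HasOrder : Carrier → ℕ → Set ℓ
  HasOrder g n = 0 < n × n · g ≈ 0# × (∀ m → 0 < m → m < n → ¬ (m · g ≈ 0#))

  negated : ∀ {p} → Pred Carrier p → Pred Carrier (c ⊔ ℓ ⊔ p)
  negated S x = ∃ λ s → s ∈ S × x ≈ - s

  Symmetric : ∀ {p} → Pred Carrier p → Set (c ⊔ ℓ ⊔ p)
  Symmetric S = S ≐ negated S

  record Subgroup (p : Level) : Set (c ⊔ ℓ ⊔ suc p) where
    field
      member : Pred Carrier p
      resp   : member Respects _≈_
      zero∈  : 0# ∈ member
      +∈     : ∀ {x y} → x ∈ member → y ∈ member → x + y ∈ member
      -∈     : ∀ {x} → x ∈ member → - x ∈ member

  data Generated {p} (X : Pred Carrier p) : Pred Carrier (c ⊔ ℓ ⊔ p) where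
    gen  : ∀ {x} → x ∈ X → Generated X x
    resp : ∀ {x y} → x ≈ y → Generated X x → Generated X y
    zero : Generated X 0#
    add  : ∀ {x y} → Generated X x → Generated X y → Generated X (x + y)
    neg  : ∀ {x} → Generated X x → Generated X (- x)

  ⟨_⟩ : ∀ {p} → Pred Carrier p → Subgroup (c ⊔ ℓ ⊔ p)
  ⟨ X ⟩ = record { member = Generated X ; resp = resp ; zero∈ = zero ; +∈ = add ; -∈ = neg }

  -- G / H: the elements of G, with x and y identified when x + H = y + H.
  cosets : ∀ {p} → Subgroup p → Setoid c p
  cosets H = record
    { Carrier = Carrier
    ; _≈_     = λ x y → (x - y) ∈ member
    ; isEquivalence = record
      { refl  = λ {x} → H.resp (S.sym (inverseʳ x)) zero∈
      ; sym   = λ {x} {y} p → H.resp (⁻¹-anti-homo‿- x y) (-∈ p)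
      ; trans = λ {x} {y} {z} p q → H.resp (telescope x y z) (+∈ p q)
      }
    }
    where
    module H = Subgroup H
    open H using (member; zero∈; +∈; -∈)
    telescope : ∀ x y z → ((x - y) + (y - z)) ≈ (x - z)
    telescope x y z =
      S.trans (assoc x (- y) (y - z))
        (∙-congˡ (S.trans (S.sym (assoc (- y) y (- z)))
          (S.trans (∙-congʳ (inverseˡ y)) (identityˡ (- z)))))

  HasIndex : ∀ {p} → Subgroup p → ℕ → Set (c ⊔ p)
  HasIndex H k = Bijection (≡.setoid (Fin k)) (cosets H)

  Index≤ : ∀ {p} → Subgroup p → ℕ → Set (c ⊔ p)
  Index≤ H n = ∃ λ k → k ≤ n × HasIndex H k

module _ {c₁ ℓ₁ c₂ ℓ₂} (G₁ : AbelianGroup c₁ ℓ₁) (G₂ : AbelianGroup c₂ ℓ₂) where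

  private
    module G₁ = AbelianGroup G₁
    module G₂ = AbelianGroup G₂
  open GroupMorphisms G₁.rawGroup G₂.rawGroup using (IsGroupIsomorphism)

  Affine : Bijection G₁.setoid G₂.setoid → Set (c₁ ⊔ ℓ₁ ⊔ c₂ ⊔ ℓ₂)
  Affine φ = Σ (G₁.Carrier → G₂.Carrier) λ τ → IsGroupIsomorphism τ ×
             ∃ λ g₂ → ∀ x → Bijection.to φ x G₂.≈ (τ x G₂.∙ g₂)

module Cayley {c ℓ p} (G : AbelianGroup c ℓ) (S : Pred (AbelianGroup.Carrier G) p) where

  open AbelianGroup G using (Carrier; _≈_; setoid; _-_) renaming (_∙_ to _+_; _⁻¹ to -_)
  open GroupNotions G

  Adjacent : Rel Carrier (c ⊔ ℓ ⊔ p)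
  Adjacent g h = ∃ λ s → s ∈ S × h ≈ g + s

  -- The trivial walk joins any two representatives of the same vertex.
  data Walk : Rel Carrier (c ⊔ ℓ ⊔ p) where
    here : ∀ {g h} → g ≈ h → Walk g h
    step : ∀ {g h k} → Adjacent g h → Walk h k → Walk g k

  Connected : Set (c ⊔ ℓ ⊔ p)
  Connected = ∀ g h → Walk g h

  record Automorphism : Set (c ⊔ ℓ ⊔ p) where
    field
      bijection : Bijection setoid setoid
    open Bijection bijection public using (to)
    field
      adjacency : ∀ g h → Adjacent g h ⇔ Adjacent (to g) (to h)

  S-setoid : Setoid (c ⊔ p) ℓ
  S-setoid = On.setoid {B = Σ Carrier S} setoid proj₁

  ColourPreserving : Automorphism → Set (c ⊔ ℓ ⊔ p)
  ColourPreserving φ = ∀ g s → s ∈ S →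
    (to (g + s) ≈ to g + s) ⊎ (to (g + s) ≈ to g - s)
    where open Automorphism φ

  -- s and t give the same colour: {±s} = {±t}.
  SameColour : Rel Carrier ℓ
  SameColour s t = (s ≈ t) ⊎ (s ≈ - t)

  -- The first condition says that {±s} ↦ {±π(s)} is well defined and injective,
  -- so that π permutes the colours.  It follows from the second one if S is
  -- finite, but not in general: if G is the direct sum of countably many copies
  -- of ℤ/2 × ℤ/2 and of ℤ/4, with the standard generators, then an automorphism
  -- can map the 4-cycle of one copy of ℤ/2 × ℤ/2 to that of a copy of ℤ/4,
  -- sending two distinct colours {s}, {s′} to a single colour {±r} by π(s) = r,
  -- π(s′) = -r.  It is not affine, although this Cayley graph is CCA.
  ColourPermuting : Automorphism → Set (c ⊔ ℓ ⊔ p)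
  ColourPermuting φ = Σ (Bijection S-setoid S-setoid) λ π →
    let π₁ = λ (s : Σ Carrier S) → proj₁ (Bijection.to π s) in
    (∀ s t → SameColour (proj₁ s) (proj₁ t) ⇔ SameColour (π₁ s) (π₁ t)) ×
    (∀ g s → (to (g + proj₁ s) ≈ to g + π₁ s) ⊎ (to (g + proj₁ s) ≈ to g - π₁ s))
    where open Automorphism φ

  CCA : Set (c ⊔ ℓ ⊔ p)
  CCA = ∀ φ → ColourPreserving φ → Affine G G (Automorphism.bijection φ)

  StronglyCCA : Set (c ⊔ ℓ ⊔ p)
  StronglyCCA = ∀ φ → ColourPermuting φ → Affine G G (Automorphism.bijection φ)

  T : Carrier → Pred Carrier (ℓ ⊔ p)
  T a = (λ t → t ∈ S × ¬ (2 · t ≈ a)) ∪ (_≈ a)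

{-# OPTIONS --safe #-}
module Submission where

-- For a colour-permuting φ, the increment Δ(g, s) = φ(g + s) − φ(g) is ±π(s), and φ
-- is affine as soon as Δ(·, s) is constant for every s ∈ S.  If Δ(g + t, s) ≠ Δ(g, s),
-- the square g, g + s, g + s + t, g + t forces 2s = 2t; the same for −s gives |s| = 4.
-- So Δ(·, s) is constant on the cosets of H = ⟨T(S, 2s)⟩, and also under translation
-- by s, which settles the case of index at most 2.  Conversely, if H has index above 2,
-- adding 2s exactly on H is a colour-preserving automorphism that is not affine.

open import Defs
open import Algebra.Bundles using (AbelianGroup)
import Algebra.Properties.AbelianGroup as AbelianGroupProperties
import Algebra.Properties.CommutativeSemigroup as CommutativeSemigroupProperties
open import Algebra.Morphism.Structures using (module GroupMorphisms)
open import Axiom.ExcludedMiddle using (ExcludedMiddle)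
open import Data.Bool.Base using (if_then_else_)
open import Data.Fin.Base using (Fin; zero; suc)
open import Data.Nat.Base using (suc; _≤_; _<_; z≤n; s≤s)
open import Data.Product.Base using (Σ; ∃; _×_; _,_; proj₁; proj₂)
open import Data.Sum.Base using (_⊎_; inj₁; inj₂)
open import Function.Base using (_∘_)
open import Function.Bundles using (Bijection; Equivalence; _⇔_; mk⇔)
import Function.Consequences.Setoid as Consequences
import Function.Construct.Identity as Identity
open import Level using (Level; _⊔_; Lift; lift; lower)
open import Relation.Binary.Bundles using (Setoid)
open import Relation.Binary.Definitions using (_Respects_)
open import Relation.Binary.PropositionalEquality.Core as ≡ using (_≡_)
import Relation.Binary.Reasoning.Setoid as SetoidReasoning
open import Relation.Nullary.Decidable.Core using (Dec; does; yes; no; map′; decidable-stable)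
open import Relation.Nullary.Negation.Core using (¬_; contradiction)
open import Relation.Unary using (Pred; _∈_; _∉_)

-- Identities in abelian groups, and elements of order 4.

module Arithmetic {c ℓ} (G : AbelianGroup c ℓ) where

  open AbelianGroup G
    renaming (_∙_ to infixl 6 _+_; ε to 0#; _⁻¹ to -_; ∙-cong to +-cong; ∙-congˡ to +-congˡ;
      ∙-congʳ to +-congʳ)
  open AbelianGroupProperties G
  open CommutativeSemigroupProperties commutativeSemigroup using (interchange)
  open GroupNotions G using (_·_; HasOrder)
  open SetoidReasoning setoid

  [x-y]+[y+z]≈x+z : ∀ x y z → (x - y) + (y + z) ≈ x + z
  [x-y]+[y+z]≈x+z x y z = begin
    (x - y) + (y + z)  ≈⟨ assoc (x - y) y z ⟨
    (x - y) + y + z    ≈⟨ +-congʳ (//-rightDividesˡ y x) ⟩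
    x + z              ∎

  [x+z]-[y+z]≈x-y : ∀ x y z → (x + z) - (y + z) ≈ x - y
  [x+z]-[y+z]≈x-y x y z = begin
    (x + z) - (y + z)      ≈⟨ +-congˡ (⁻¹-∙-comm y z) ⟨
    (x + z) + (- y + - z)  ≈⟨ interchange x z (- y) (- z) ⟩
    (x - y) + (z - z)      ≈⟨ +-congˡ (inverseʳ z) ⟩
    (x - y) + 0#           ≈⟨ identityʳ (x - y) ⟩
    x - y                  ∎

  x-0≈x : ∀ x → x - 0# ≈ x
  x-0≈x x = trans (+-congˡ ε⁻¹≈ε) (identityʳ x)

  -- Adding `y + x` to both sides does it. This is what a square of increments yields when both
  -- pairs of opposite sides change sign.
  x-y≈y-x⇒x+x≈y+y : ∀ {x y} → x - y ≈ y - x → x + x ≈ y + y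
  x-y≈y-x⇒x+x≈y+y {x} {y} eq = begin
    x + x              ≈⟨ [x-y]+[y+z]≈x+z x y x ⟨
    (x - y) + (y + x)  ≈⟨ +-cong eq (comm y x) ⟩
    (y - x) + (x + y)  ≈⟨ [x-y]+[y+z]≈x+z y x y ⟩
    y + y              ∎

  x+x≈0⇒x≈-x : ∀ {x} → x + x ≈ 0# → x ≈ - x
  x+x≈0⇒x≈-x {x} = inverseˡ-unique x x

  2·x≈x+x : ∀ x → 2 · x ≈ x + x
  2·x≈x+x x = +-congˡ (identityʳ x)

  4·x≈2·x+2·x : ∀ x → 4 · x ≈ (2 · x) + (2 · x)
  4·x≈2·x+2·x x = begin
    x + (x + (2 · x))    ≈⟨ assoc x x (2 · x) ⟨
    x + x + (2 · x)      ≈⟨ +-congʳ (2·x≈x+x x) ⟨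
    (2 · x) + (2 · x)    ∎

  -- The exponents 1 and 3 reduce to 2: if `3 · s` vanishes along with `4 · s`, then `s` itself
  -- vanishes, and hence so does its double.
  hasOrder4 : ∀ {s} → ¬ (2 · s ≈ 0#) → (2 · s) + (2 · s) ≈ 0# → HasOrder s 4
  hasOrder4 {s} 2s≉0 4s≈0 = s≤s z≤n , 4·s≈0 , minimal
    where
    4·s≈0 : 4 · s ≈ 0#
    4·s≈0 = trans (4·x≈2·x+2·x s) 4s≈0

    s≈0⇒2·s≈0 : s ≈ 0# → 2 · s ≈ 0#
    s≈0⇒2·s≈0 s≈0 = begin
      2 · s    ≈⟨ 2·x≈x+x s ⟩
      s + s    ≈⟨ +-cong s≈0 s≈0 ⟩
      0# + 0#  ≈⟨ identityʳ 0# ⟩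
      0#       ∎

    minimal : ∀ m → 0 < m → m < 4 → ¬ (m · s ≈ 0#)
    minimal 1 _ _ 1·s≈0 = 2s≉0 (s≈0⇒2·s≈0 (trans (sym (identityʳ s)) 1·s≈0))
    minimal 2 _ _ = 2s≉0
    minimal 3 _ _ 3·s≈0 = 2s≉0 (s≈0⇒2·s≈0 (begin
      s            ≈⟨ identityʳ s ⟨
      s + 0#       ≈⟨ +-congˡ 3·s≈0 ⟨
      s + (3 · s)  ≈⟨ 4·s≈0 ⟩
      0#           ∎))
    minimal (suc (suc (suc (suc _)))) _ (s≤s (s≤s (s≤s (s≤s ()))))

module _ {c ℓ} (G : AbelianGroup c ℓ) where

  open AbelianGroup G
    renaming (_∙_ to infixl 6 _+_; ε to 0#; _⁻¹ to -_; ∙-congˡ to +-congˡ; ∙-congʳ to +-congʳ)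
  open AbelianGroupProperties G
  open Arithmetic G
  open GroupNotions G

  -- Subgroups of index at most 2.

  module _ {p} (H : Subgroup p) where

    open Subgroup H using (member) renaming (resp to ∈-resp)
    private module G/H = Setoid (cosets H)

    -- Pigeonhole: elements outside `H` have an index different from that of `0#`, and at most two
    -- indices leave only one other value. The index hypothesis is exploited in this form alone.
    index≤2⇒x-y∈H : Index≤ H 2 → ∀ {x y} → x ∉ member → y ∉ member → (x - y) ∈ member
    index≤2⇒x-y∈H (k , k≤2 , ψ) {x} {y} x∉H y∉H =
      G/H.trans (G/H.sym (hit x)) (G/H.trans (G/H.reflexive (≡.cong to index-x≡index-y)) (hit y))
      where
      open Bijection ψ using (to; strictlySurjective)

      index : Carrier → Fin k
      index z = proj₁ (strictlySurjective z)

      hit : ∀ z → (to (index z) - z) ∈ member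
      hit z = proj₂ (strictlySurjective z)

      index-z≢index-0 : ∀ {z} → z ∉ member → ¬ (index z ≡ index 0#)
      index-z≢index-0 {z} z∉H eq = z∉H (∈-resp (x-0≈x z)
        (G/H.trans (G/H.sym (hit z)) (G/H.trans (G/H.reflexive (≡.cong to eq)) (hit 0#))))

      at-most-two : ∀ {k} → k ≤ 2 → (i j l : Fin k) → ¬ (i ≡ l) → ¬ (j ≡ l) → i ≡ j
      at-most-two _ zero       zero       _          _   _   = ≡.refl
      at-most-two _ (suc zero) (suc zero) _          _   _   = ≡.refl
      at-most-two _ zero       (suc zero) zero       i≢l _   = contradiction ≡.refl i≢l
      at-most-two _ zero       (suc zero) (suc zero) _   j≢l = contradiction ≡.refl j≢l
      at-most-two _ (suc zero) zero       zero       _   j≢l = contradiction ≡.refl j≢l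
      at-most-two _ (suc zero) zero       (suc zero) i≢l _   = contradiction ≡.refl i≢l
      -- Matching on the bound refines `k` to 2, and then `Fin k` has no index beyond the first two.
      at-most-two (s≤s (s≤s z≤n)) (suc (suc ())) _ _ _ _
      at-most-two (s≤s (s≤s z≤n)) _ (suc (suc ())) _ _ _
      at-most-two (s≤s (s≤s z≤n)) _ _ (suc (suc ())) _ _

      index-x≡index-y : index x ≡ index y
      index-x≡index-y =
        at-most-two k≤2 (index x) (index y) (index 0#) (index-z≢index-0 x∉H) (index-z≢index-0 y∉H)

    ∈H⇒0≈ : ∀ {y} → y ∈ member → 0# G/H.≈ y
    ∈H⇒0≈ {y} y∈H = G/H.sym (∈-resp (sym (x-0≈x y)) y∈H)

    -- Excluded middle decides whether some `a` lies outside `H`. If none does, `0#` represents the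
    -- only coset; otherwise `0#` and `a` represent the two cosets.
    x-y∈H⇒index≤2 : ExcludedMiddle (c ⊔ p) → (∀ x → Dec (x ∈ member)) →
      (∀ {x y} → x ∉ member → y ∉ member → (x - y) ∈ member) → Index≤ H 2
    x-y∈H⇒index≤2 em _∈?H x-y∈H with em {∃ λ x → x ∉ member}
    ... | no  H-full = 1 , s≤s z≤n , record
      { to        = to
      ; cong      = G/H.reflexive ∘ ≡.cong to
      ; bijective = (λ { {zero} {zero} _ → ≡.refl })
                  , λ y → zero , λ _ →
                      ∈H⇒0≈ (decidable-stable (y ∈?H) (λ y∉H → H-full (y , y∉H)))
      }
      where
      to : Fin 1 → Carrier
      to _ = 0#
    ... | yes (a , a∉H) = 2 , s≤s (s≤s z≤n) , record
      { to        = to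
      ; cong      = G/H.reflexive ∘ ≡.cong to
      ; bijective = injective , surjective
      }
      where
      to : Fin 2 → Carrier
      to zero    = 0#
      to (suc _) = a

      a≉0 : ¬ (a G/H.≈ 0#)
      a≉0 a≈0 = a∉H (∈-resp (x-0≈x a) a≈0)

      injective : ∀ {i j} → to i G/H.≈ to j → i ≡ j
      injective {zero}     {zero}     _   = ≡.refl
      injective {zero}     {suc zero} 0≈a = contradiction (G/H.sym 0≈a) a≉0
      injective {suc zero} {zero}     a≈0 = contradiction a≈0 a≉0
      injective {suc zero} {suc zero} _   = ≡.refl

      strictlySurjective : ∀ y → ∃ λ i → to i G/H.≈ y
      strictlySurjective y with y ∈?H
      ... | yes y∈H = zero , ∈H⇒0≈ y∈H
      ... | no  y∉H = suc zero , x-y∈H a∉H y∉H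

      surjective : ∀ y → ∃ λ i → ∀ {j} → j ≡ i → to j G/H.≈ y
      surjective y with strictlySurjective y
      ... | i , toi≈y = i , λ { ≡.refl → toi≈y }

  -- A criterion for a bijection to be affine.

  open SetoidReasoning setoid

  -- Subtracting `to 0#` gives a map `τ` that fixes `0#`, and the hypothesis amounts to additivity
  -- of `τ`.
  uniform⇒affine : (φ : Bijection setoid setoid) → let open Bijection φ using (to) in
    (∀ g x → to (g + x) - to g ≈ to x - to 0#) → Affine G G φ
  uniform⇒affine φ uniform = τ , isGroupIsomorphism , to 0# , λ x → sym (//-rightDividesˡ (to 0#) (to x))
    where
    open Bijection φ using (to; cong; injective; strictlySurjective)
    open Consequences setoid setoid using (strictlySurjective⇒surjective)

    τ : Carrier → Carrier
    τ x = to x - to 0#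

    τ-cong : ∀ {x y} → x ≈ y → τ x ≈ τ y
    τ-cong x≈y = +-congʳ (cong x≈y)

    τ-homo : ∀ x y → τ (x + y) ≈ τ x + τ y
    τ-homo x y = begin
      to (x + y) - to 0#                   ≈⟨ [x-y]+[y+z]≈x+z (to (x + y)) (to x) (- to 0#) ⟨
      (to (x + y) - to x) + (to x - to 0#) ≈⟨ comm _ _ ⟩
      τ x + (to (x + y) - to x)            ≈⟨ +-congˡ (uniform x y) ⟩
      τ x + τ y                            ∎

    τ-zero : τ 0# ≈ 0#
    τ-zero = inverseʳ (to 0#)

    τ-neg : ∀ x → τ (- x) ≈ - τ x
    τ-neg x = inverseʳ-unique (τ x) (τ (- x)) (begin
      τ x + τ (- x)  ≈⟨ τ-homo x (- x) ⟨
      τ (x - x)      ≈⟨ τ-cong (inverseʳ x) ⟩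
      τ 0#           ≈⟨ τ-zero ⟩
      0#             ∎)

    τ-strictlySurjective : ∀ y → ∃ λ x → τ x ≈ y
    τ-strictlySurjective y with strictlySurjective (y + to 0#)
    ... | x , eq = x , trans (+-congʳ eq) (//-rightDividesʳ (to 0#) y)

    isGroupIsomorphism = record
      { isGroupMonomorphism = record
        { isGroupHomomorphism = record
          { isMonoidHomomorphism = record
            { isMagmaHomomorphism = record
              { isRelHomomorphism = record { cong = τ-cong }
              ; homo              = τ-homo
              }
            ; ε-homo = τ-zero
            }
          ; ⁻¹-homo = τ-neg
          }
        ; injective = λ {x} {y} eq → injective (∙-cancelʳ (- to 0#) (to x) (to y) eq)
        }
      ; surjective = strictlySurjective⇒surjective τ-cong τ-strictlySurjective
      }

-- The twist by an element of order 4, for the necessity of the index condition.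

module _ {c ℓ p} (em : ExcludedMiddle (c ⊔ ℓ ⊔ p))
  (G : AbelianGroup c ℓ) (S : Pred (AbelianGroup.Carrier G) p)
  (S-symmetric : GroupNotions.Symmetric G S)
  where

  open AbelianGroup G
    renaming (_∙_ to infixl 6 _+_; ε to 0#; _⁻¹ to -_; ∙-cong to +-cong; ∙-congˡ to +-congˡ;
      ∙-congʳ to +-congʳ; ⁻¹-cong to -‿cong)
  open AbelianGroupProperties G
  open CommutativeSemigroupProperties commutativeSemigroup using (interchange; xy∙z≈xz∙y)
  open Arithmetic G
  open GroupNotions G
  open Cayley G S
  open GroupMorphisms rawGroup rawGroup using (IsGroupIsomorphism)
  open SetoidReasoning setoid

  _≟_ : ∀ x y → Dec (x ≈ y)
  x ≟ y = map′ lower lift (em {Lift (c ⊔ p) (x ≈ y)})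

  S-neg : ∀ {s} → s ∈ S → - s ∈ S
  S-neg s∈S = proj₂ S-symmetric (_ , s∈S , refl)

  -- Elements t of S outside H satisfy 2t = 2s, so t + 2s = −t: adding 2s to some
  -- cosets of H and not to others preserves colours.
  module Twist {s} (s∈S : s ∈ S) (|s|≡4 : HasOrder s 4) where

    H = ⟨ T (2 · s) ⟩
    open Subgroup H using (member) renaming (resp to ∈-resp; +∈ to H-add)
    private module G/H = Setoid (cosets H)

    2s+2s≈0 : (2 · s) + (2 · s) ≈ 0#
    2s+2s≈0 = trans (sym (4·x≈2·x+2·x s)) (proj₁ (proj₂ |s|≡4))

    2s≉0 : ¬ (2 · s ≈ 0#)
    2s≉0 = proj₂ (proj₂ |s|≡4) 2 (s≤s z≤n) (s≤s (s≤s (s≤s z≤n)))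

    2s∈H : 2 · s ∈ member
    2s∈H = gen (inj₂ refl)

    _∈?H : ∀ x → Dec (x ∈ member)
    x ∈?H = em

    χ : Carrier → Carrier
    χ x = if does (x ∈?H) then 2 · s else 0#

    χ-∈ : ∀ {x} → x ∈ member → χ x ≈ 2 · s
    χ-∈ {x} x∈H with x ∈?H
    ... | yes _  = refl
    ... | no x∉H = contradiction x∈H x∉H

    χ-∉ : ∀ {x} → x ∉ member → χ x ≈ 0#
    χ-∉ {x} x∉H with x ∈?H
    ... | yes x∈H = contradiction x∈H x∉H
    ... | no _    = refl

    χ∈H : ∀ x → χ x ∈ member
    χ∈H x with x ∈?H
    ... | yes _ = 2s∈H
    ... | no _  = zero

    χ+χ≈0 : ∀ x → χ x + χ x ≈ 0#
    χ+χ≈0 x with x ∈?H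
    ... | yes _ = 2s+2s≈0
    ... | no _  = identityʳ 0#

    χ-coset : ∀ {x y} → x G/H.≈ y → χ x ≈ χ y
    χ-coset {x} {y} x≈y with y ∈?H
    ... | yes y∈H = χ-∈ (∈-resp (//-rightDividesˡ y x) (H-add x≈y y∈H))
    ... | no y∉H  = χ-∉ λ x∈H → y∉H (∈-resp (//-rightDividesˡ x y) (H-add (G/H.sym {x} {y} x≈y) x∈H))

    -- Since `2 · s` is its own negative, a change between the values `0#` and `2 · s` adds `2 · s`
    -- in either direction.
    χ-dichotomy : ∀ x y → χ x ≈ χ y ⊎ χ x ≈ χ y + (2 · s)
    χ-dichotomy x y with x ∈?H | y ∈?H
    ... | yes _ | yes _ = inj₁ refl
    ... | yes _ | no _  = inj₂ (sym (identityˡ (2 · s)))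
    ... | no _  | yes _ = inj₂ (sym 2s+2s≈0)
    ... | no _  | no _  = inj₁ refl

    χ-shift : ∀ {h} x → h ∈ member → χ (x + h) ≈ χ x
    χ-shift {h} x h∈H = χ-coset (∈-resp (sym (xyx⁻¹≈y x h)) h∈H)

    φ : Carrier → Carrier
    φ x = x + χ x

    φ-cong : ∀ {x y} → x ≈ y → φ x ≈ φ y
    φ-cong {x} {y} x≈y = +-cong x≈y (χ-coset (∈-resp (sym (x≈y⇒x∙y⁻¹≈ε x≈y)) zero))

    -- The values of `χ` lie in `H`, so `φ` preserves each coset, and a second application adds the
    -- same element, whose double vanishes. Bijectivity follows, and reflecting adjacency reduces to
    -- preserving it.
    φ-involutive : ∀ x → φ (φ x) ≈ x
    φ-involutive x = begin
      (x + χ x) + χ (x + χ x)  ≈⟨ +-congˡ (χ-shift x (χ∈H x)) ⟩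
      (x + χ x) + χ x          ≈⟨ assoc x (χ x) (χ x) ⟩
      x + (χ x + χ x)          ≈⟨ +-congˡ (χ+χ≈0 x) ⟩
      x + 0#                   ≈⟨ identityʳ x ⟩
      x                        ∎

    φ-constant-shift : ∀ {g t} → χ (g + t) ≈ χ g → φ (g + t) ≈ φ g + t
    φ-constant-shift {g} {t} eq = trans (+-congˡ eq) (xy∙z≈xz∙y g t (χ g))

    t+2s≈-t : ∀ {t} → 2 · t ≈ 2 · s → t + (2 · s) ≈ - t
    t+2s≈-t {t} 2t≈2s = inverseʳ-unique t (t + (2 · s)) (begin
      t + (t + (2 · s))  ≈⟨ assoc t t (2 · s) ⟨
      t + t + (2 · s)    ≈⟨ +-congʳ (2·x≈x+x t) ⟨
      (2 · t) + (2 · s)  ≈⟨ +-congʳ 2t≈2s ⟩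
      (2 · s) + (2 · s)  ≈⟨ 2s+2s≈0 ⟩
      0#                 ∎)

    φ-preserves-colours : ∀ g t → t ∈ S → φ (g + t) ≈ φ g + t ⊎ φ (g + t) ≈ φ g - t
    φ-preserves-colours g t t∈S with (2 · t) ≟ (2 · s)
    ... | no 2t≉2s  = inj₁ (φ-constant-shift (χ-shift g (gen (inj₁ (t∈S , 2t≉2s)))))
    ... | yes 2t≈2s with χ-dichotomy (g + t) g
    ...   | inj₁ eq = inj₁ (φ-constant-shift eq)
    ...   | inj₂ eq = inj₂ (begin
      (g + t) + χ (g + t)          ≈⟨ +-congˡ eq ⟩
      (g + t) + (χ g + (2 · s))    ≈⟨ interchange g t (χ g) (2 · s) ⟩
      (g + χ g) + (t + (2 · s))    ≈⟨ +-congˡ (t+2s≈-t 2t≈2s) ⟩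
      (g + χ g) - t                ∎)

    φ-adjacent : ∀ {g h} → Adjacent g h → Adjacent (φ g) (φ h)
    φ-adjacent {g} (t , t∈S , h≈g+t) with φ-preserves-colours g t t∈S
    ... | inj₁ eq = t , t∈S , trans (φ-cong h≈g+t) eq
    ... | inj₂ eq = - t , S-neg t∈S , trans (φ-cong h≈g+t) eq

    φ-adjacent⁻ : ∀ {g h} → Adjacent (φ g) (φ h) → Adjacent g h
    φ-adjacent⁻ {g} {h} adj with φ-adjacent adj
    ... | t , t∈S , eq = t , t∈S , trans (sym (φ-involutive h)) (trans eq (+-congʳ (φ-involutive g)))

    automorphism : Automorphism
    automorphism = record
      { bijection = record
        { to        = φ
        ; cong      = φ-cong
        ; bijective = (λ {x} {y} eq → trans (sym (φ-involutive x)) (trans (φ-cong eq) (φ-involutive y)))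
                    , strictlySurjective⇒surjective φ-cong (λ y → φ y , φ-involutive y)
        }
      ; adjacency = λ g h → mk⇔ φ-adjacent φ-adjacent⁻
      }
      where open Consequences setoid setoid using (strictlySurjective⇒surjective)

    φ-fixes : ∀ {x} → x ∉ member → φ x ≈ x
    φ-fixes x∉H = trans (+-congˡ (χ-∉ x∉H)) (identityʳ _)

    -- If a, b and a − b were all outside H, hence fixed by φ, then so would be 0.
    affine⇒a-b∈H : Affine G G (Automorphism.bijection automorphism) →
      ∀ {a b} → a ∉ member → b ∉ member → (a - b) ∈ member
    affine⇒a-b∈H (τ , τ-iso , g₂ , φ≈τ+g₂) {a} {b} a∉H b∉H =
      decidable-stable ((a - b) ∈?H) λ a-b∉H → 2s≉0 (begin
        2 · s                 ≈⟨ χ-∈ zero ⟨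
        χ 0#                  ≈⟨ identityˡ (χ 0#) ⟨
        φ 0#                  ≈⟨ φ≈τ+g₂ 0# ⟩
        τ 0# + g₂             ≈⟨ +-congʳ ε-homo ⟩
        0# + g₂               ≈⟨ identityˡ g₂ ⟩
        g₂                    ≈⟨ identityʳ-unique (τ (a - b)) g₂ (g₂-cancels a-b∉H) ⟩
        0#                    ∎)
      where
      open IsGroupIsomorphism τ-iso using (∙-homo; ε-homo; ⁻¹-homo)

      g₂-cancels : (a - b) ∉ member → τ (a - b) + g₂ ≈ τ (a - b)
      g₂-cancels a-b∉H = begin
        τ (a - b) + g₂           ≈⟨ φ≈τ+g₂ (a - b) ⟨
        φ (a - b)                ≈⟨ φ-fixes a-b∉H ⟩
        a - b                    ≈⟨ //-cong₂ (φ-fixes a∉H) (φ-fixes b∉H) ⟨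
        φ a - φ b                ≈⟨ //-cong₂ (φ≈τ+g₂ a) (φ≈τ+g₂ b) ⟩
        (τ a + g₂) - (τ b + g₂)  ≈⟨ [x+z]-[y+z]≈x-y (τ a) (τ b) g₂ ⟩
        τ a - τ b                ≈⟨ +-congˡ (⁻¹-homo b) ⟨
        τ a + τ (- b)            ≈⟨ ∙-homo a (- b) ⟨
        τ (a - b)                ∎

  -- The implications from CCA to the index condition and from strongly CCA to CCA.

  CCA⇒index≤2 : CCA → ∀ s → s ∈ S → HasOrder s 4 → Index≤ ⟨ T (2 · s) ⟩ 2
  CCA⇒index≤2 cca s s∈S |s|≡4 =
    x-y∈H⇒index≤2 G H em (λ _ → em) (affine⇒a-b∈H (cca automorphism φ-preserves-colours))
    where open Twist s∈S |s|≡4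

  -- Preserving colours is permuting them by the identity.
  stronglyCCA⇒CCA : StronglyCCA → CCA
  stronglyCCA⇒CCA stronglyCCA φ preserves =
    stronglyCCA φ (Identity.bijection S-setoid , (λ _ _ → Identity.⇔-id _) , λ { g (s , s∈S) → preserves g s s∈S })

  -- Increments of a colour-permuting automorphism.

  module Straightening (Φ : Automorphism) (permuting : ColourPermuting Φ) where

    open Automorphism Φ using (bijection; to)
    open Bijection bijection using (injective) renaming (cong to to-cong)
    open Bijection (proj₁ permuting) using ()
      renaming (to to π; cong to π-cong; strictlySurjective to π-surjective)

    π₁ : Σ Carrier S → Carrier
    π₁ s = proj₁ (π s)

    Δ : Carrier → Carrier → Carrier
    Δ g x = to (g + x) - to g

    Δ-cong : ∀ {g h x y} → g ≈ h → x ≈ y → Δ g x ≈ Δ h y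
    Δ-cong g≈h x≈y = //-cong₂ (to-cong (+-cong g≈h x≈y)) (to-cong g≈h)

    Δ-cocycle : ∀ g x y → Δ g (x + y) ≈ Δ g x + Δ (g + x) y
    Δ-cocycle g x y = begin
      to (g + (x + y)) - to g           ≈⟨ +-congʳ (to-cong (assoc g x y)) ⟨
      to (g + x + y) - to g             ≈⟨ [x-y]+[y+z]≈x+z _ (to (g + x)) (- to g) ⟨
      Δ (g + x) y + Δ g x               ≈⟨ comm _ _ ⟩
      Δ g x + Δ (g + x) y               ∎

    Δ-injective : ∀ {g x y} → Δ g x ≈ Δ g y → x ≈ y
    Δ-injective {g} {x} {y} eq = ∙-cancelˡ g x y (injective (∙-cancelʳ (- to g) _ _ eq))

    Δ-zero : ∀ g → Δ g 0# ≈ 0#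
    Δ-zero g = x≈y⇒x∙y⁻¹≈ε (to-cong (identityʳ g))

    Δ-neg : ∀ g x → Δ g (- x) ≈ - Δ (g - x) x
    Δ-neg g x = inverseˡ-unique _ _ (begin
      Δ g (- x) + Δ (g - x) x  ≈⟨ Δ-cocycle g (- x) x ⟨
      Δ g (- x + x)            ≈⟨ Δ-cong refl (inverseˡ x) ⟩
      Δ g 0#                   ≈⟨ Δ-zero g ⟩
      0#                       ∎)

    Δ≈±π : ∀ g s → Δ g (proj₁ s) ≈ π₁ s ⊎ Δ g (proj₁ s) ≈ - π₁ s
    Δ≈±π g s with proj₂ (proj₂ permuting) g s
    ... | inj₁ eq = inj₁ (trans (+-congʳ eq) (xyx⁻¹≈y (to g) (π₁ s)))
    ... | inj₂ eq = inj₂ (trans (+-congʳ eq) (xyx⁻¹≈y (to g) (- π₁ s)))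

    -- Injectivity of π on colours: −π(s) has a preimage of the same colour as s.
    π-involution : ∀ s → proj₁ s ≈ - proj₁ s → π₁ s ≈ - π₁ s
    π-involution s s≈-s with π-surjective (- π₁ s , S-neg (proj₂ (π s)))
    ... | s′ , πs′≈-πs = trans (π-cong {s} {s′} s≈s′) πs′≈-πs
      where
      πs≈-πs′ : π₁ s ≈ - π₁ s′
      πs≈-πs′ = sym (trans (-‿cong πs′≈-πs) (⁻¹-involutive (π₁ s)))

      s≈s′ : proj₁ s ≈ proj₁ s′
      s≈s′ with Equivalence.from (proj₁ (proj₂ permuting) s s′) (inj₂ πs≈-πs′)
      ... | inj₁ eq = eq
      ... | inj₂ eq = trans s≈-s (trans (-‿cong eq) (⁻¹-involutive (proj₁ s′)))

    -- Both increments are `π₁` of `s` up to sign. This eliminates `π`: of the lemmas below, only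
    -- `Δ-involution` still refers to it.
    Δ-dichotomy : ∀ {s} → s ∈ S → ∀ g h → Δ g s ≈ Δ h s ⊎ Δ g s ≈ - Δ h s
    Δ-dichotomy {s} s∈S g h with Δ≈±π g (s , s∈S) | Δ≈±π h (s , s∈S)
    ... | inj₁ p | inj₁ q = inj₁ (trans p (sym q))
    ... | inj₂ p | inj₂ q = inj₁ (trans p (sym q))
    ... | inj₁ p | inj₂ q = inj₂ (trans p (sym (trans (-‿cong q) (⁻¹-involutive _))))
    ... | inj₂ p | inj₁ q = inj₂ (trans p (-‿cong (sym q)))

    -- By `π-involution` the two signs of `π₁` of `s` give the same element, so the ambiguity
    -- disappears.
    Δ-involution : ∀ {s} → s ∈ S → s + s ≈ 0# → ∀ g h → Δ g s ≈ Δ h s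
    Δ-involution {s} s∈S 2s≈0 g h = trans (Δ≈π g) (sym (Δ≈π h))
      where
      Δ≈π : ∀ g → Δ g s ≈ π₁ (s , s∈S)
      Δ≈π g with Δ≈±π g (s , s∈S)
      ... | inj₁ eq = eq
      ... | inj₂ eq = trans eq (sym (π-involution (s , s∈S) (x+x≈0⇒x≈-x 2s≈0)))

    -- If the sign changed, two consecutive steps along `s` would cancel. Injectivity then gives
    -- `s + s ≈ 0#`, a case in which increments are constant anyway.
    Δ-along : ∀ {s} → s ∈ S → ∀ g → Δ (g + s) s ≈ Δ g s
    Δ-along {s} s∈S g with Δ-dichotomy s∈S (g + s) g
    ... | inj₁ eq = eq
    ... | inj₂ eq = Δ-involution s∈S (Δ-injective (begin
      Δ g (s + s)            ≈⟨ Δ-cocycle g s s ⟩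
      Δ g s + Δ (g + s) s    ≈⟨ +-congˡ eq ⟩
      Δ g s - Δ g s          ≈⟨ inverseʳ (Δ g s) ⟩
      0#                     ≈⟨ Δ-zero g ⟨
      Δ g 0#                 ∎)) (g + s) g

    Δ-double : ∀ {s} → s ∈ S → ∀ g → Δ g (2 · s) ≈ Δ g s + Δ g s
    Δ-double {s} s∈S g = begin
      Δ g (2 · s)          ≈⟨ Δ-cong refl (2·x≈x+x s) ⟩
      Δ g (s + s)          ≈⟨ Δ-cocycle g s s ⟩
      Δ g s + Δ (g + s) s  ≈⟨ +-congˡ (Δ-along s∈S g) ⟩
      Δ g s + Δ g s        ∎

    Δ-odd : ∀ {s} → s ∈ S → ∀ g → Δ g (- s) ≈ - Δ g s
    Δ-odd {s} s∈S g = begin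
      Δ g (- s)            ≈⟨ Δ-neg g s ⟩
      - Δ (g - s) s        ≈⟨ -‿cong (Δ-along s∈S (g - s)) ⟨
      - Δ (g - s + s) s    ≈⟨ -‿cong (Δ-cong (//-rightDividesˡ s g) refl) ⟩
      - Δ g s              ∎

    -- The two sides are the two paths from `g` to the opposite corner of the square spanned by `s`
    -- and `t`.
    Δ-square : ∀ g s t → Δ g s + Δ (g + s) t ≈ Δ g t + Δ (g + t) s
    Δ-square g s t = begin
      Δ g s + Δ (g + s) t  ≈⟨ Δ-cocycle g s t ⟨
      Δ g (s + t)          ≈⟨ Δ-cong refl (comm s t) ⟩
      Δ g (t + s)          ≈⟨ Δ-cocycle g t s ⟩
      Δ g t + Δ (g + t) s  ∎

    -- Once one pair of opposite sides of the square agrees, it cancels from `Δ-square` and the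
    -- other pair agrees too. Contrapositively, if `t` flips `s` at `g`, then `s` flips `t` at `g`.
    flip-mutual : ∀ {g s t} → Δ (g + s) t ≈ Δ g t → Δ (g + t) s ≈ Δ g s
    flip-mutual {g} {s} {t} eq = ∙-cancelˡ (Δ g t) _ _ (begin
      Δ g t + Δ (g + t) s  ≈⟨ Δ-square g s t ⟨
      Δ g s + Δ (g + s) t  ≈⟨ +-congˡ eq ⟩
      Δ g s + Δ g t        ≈⟨ comm _ _ ⟩
      Δ g t + Δ g s        ∎)

    -- A flip is mutual and is a change of sign, so with `a = Δ g s` and `b = Δ g t` the square
    -- relation reads `a - b ≈ b - a`, whence `a + a ≈ b + b`. By `Δ-double` these are the
    -- increments along `2 · s` and `2 · t`, and increments at `g` are injective.
    flip⇒2s≈2t : ∀ {g s t} → s ∈ S → t ∈ S → ¬ (Δ (g + t) s ≈ Δ g s) → 2 · s ≈ 2 · t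
    flip⇒2s≈2t {g} {s} {t} s∈S t∈S flip
      with Δ-dichotomy s∈S (g + t) g | Δ-dichotomy t∈S (g + s) g
    ... | inj₁ eq | _       = contradiction eq flip
    ... | inj₂ _  | inj₁ eq = contradiction (flip-mutual eq) flip
    ... | inj₂ eq-s | inj₂ eq-t = Δ-injective (begin
      Δ g (2 · s)    ≈⟨ Δ-double s∈S g ⟩
      Δ g s + Δ g s  ≈⟨ x-y≈y-x⇒x+x≈y+y (trans (+-congˡ (sym eq-t)) (trans (Δ-square g s t) (+-congˡ eq-s))) ⟩
      Δ g t + Δ g t  ≈⟨ Δ-double t∈S g ⟨
      Δ g (2 · t)    ∎)

    -- Applied to s and to −s, the previous lemma gives 2s = 2t = −2s.
    flip⇒hasOrder4 : ∀ {g s t} → s ∈ S → t ∈ S → ¬ (Δ (g + t) s ≈ Δ g s) → HasOrder s 4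
    flip⇒hasOrder4 {g} {s} {t} s∈S t∈S flip = hasOrder4 2s≉0 (begin
      (2 · s) + (2 · s)    ≈⟨ +-cong (trans 2s≈2t (sym -2s≈2t)) (2·x≈x+x s) ⟩
      (2 · (- s)) + (s + s)  ≈⟨ +-congʳ (2·x≈x+x (- s)) ⟩
      (- s - s) + (s + s)    ≈⟨ [x-y]+[y+z]≈x+z (- s) s s ⟩
      - s + s                ≈⟨ inverseˡ s ⟩
      0#                     ∎)
      where
      2s≈2t : 2 · s ≈ 2 · t
      2s≈2t = flip⇒2s≈2t s∈S t∈S flip

      -2s≈2t : 2 · (- s) ≈ 2 · t
      -2s≈2t = flip⇒2s≈2t (S-neg s∈S) t∈S λ eq →
        flip (⁻¹-injective (trans (sym (Δ-odd s∈S (g + t))) (trans eq (Δ-odd s∈S g))))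

      2s≉0 : ¬ (2 · s ≈ 0#)
      2s≉0 2s≈0 = flip (Δ-involution s∈S (trans (sym (2·x≈x+x s)) 2s≈0) (g + t) g)

    -- A generator `t` with a different double cannot flip `s`, and translation by `2 · s` is two
    -- steps along `s`. The induction needs all base points `g` at once. Keeping `a` apart from
    -- `2 · s` allows `⟨ T (2 · s) ⟩` to be used for another `t` with the same double.
    Δ-invariant : ∀ {a s x} → s ∈ S → 2 · s ≈ a → x ∈ Generated (T a) → ∀ g → Δ (g + x) s ≈ Δ g s
    Δ-invariant {a} {s} s∈S 2s≈a = go
      where
      go : ∀ {x} → x ∈ Generated (T a) → ∀ g → Δ (g + x) s ≈ Δ g s
      go (gen {t} (inj₁ (t∈S , 2t≉a))) g = decidable-stable (_ ≟ _) λ flip →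
        2t≉a (trans (sym (flip⇒2s≈2t s∈S t∈S flip)) 2s≈a)
      go (gen {x} (inj₂ x≈a)) g = begin
        Δ (g + x) s        ≈⟨ Δ-cong (+-congˡ (trans x≈a (trans (sym 2s≈a) (2·x≈x+x s)))) refl ⟩
        Δ (g + (s + s)) s  ≈⟨ Δ-cong (assoc g s s) refl ⟨
        Δ (g + s + s) s    ≈⟨ Δ-along s∈S (g + s) ⟩
        Δ (g + s) s        ≈⟨ Δ-along s∈S g ⟩
        Δ g s              ∎
      go (resp x≈y x∈) g = trans (Δ-cong (+-congˡ (sym x≈y)) refl) (go x∈ g)
      go zero g = Δ-cong (identityʳ g) refl
      go (add {x} {y} x∈ y∈) g = begin
        Δ (g + (x + y)) s  ≈⟨ Δ-cong (assoc g x y) refl ⟨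
        Δ (g + x + y) s    ≈⟨ go y∈ (g + x) ⟩
        Δ (g + x) s        ≈⟨ go x∈ g ⟩
        Δ g s              ∎
      go (neg {x} x∈) g = begin
        Δ (g - x) s        ≈⟨ go x∈ (g - x) ⟨
        Δ (g - x + x) s    ≈⟨ Δ-cong (//-rightDividesˡ x g) refl ⟩
        Δ g s              ∎

    -- Affinity under the index condition.

    module _ (index≤2 : ∀ s → s ∈ S → HasOrder s 4 → Index≤ ⟨ T (2 · s) ⟩ 2) where

      -- If t flips s then s flips t, so neither lies in H = ⟨T(2s)⟩ = ⟨T(2t)⟩;
      -- hence t − s ∈ H, and t acts on Δ(·, s) as s does, that is, trivially.
      no-flip : ∀ {s t} → s ∈ S → t ∈ S → ∀ g → Δ (g + t) s ≈ Δ g s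
      no-flip {s} {t} s∈S t∈S g = decidable-stable (_ ≟ _) λ flip →
        let
          2t≈2s = sym (flip⇒2s≈2t s∈S t∈S flip)
          t∉H = λ t∈H → flip (Δ-invariant s∈S refl t∈H g)
          s∉H = λ s∈H → flip (flip-mutual (Δ-invariant t∈S 2t≈2s s∈H g))
          t-s∈H = index≤2⇒x-y∈H G ⟨ T (2 · s) ⟩ (index≤2 s s∈S (flip⇒hasOrder4 s∈S t∈S flip)) t∉H s∉H
        in flip (begin
          Δ (g + t) s              ≈⟨ Δ-cong (+-congˡ (trans (sym (//-rightDividesˡ s t)) (comm _ _))) refl ⟩
          Δ (g + (s + (t - s))) s  ≈⟨ Δ-cong (assoc g s (t - s)) refl ⟨
          Δ (g + s + (t - s)) s    ≈⟨ Δ-invariant s∈S refl t-s∈H (g + s) ⟩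
          Δ (g + s) s              ≈⟨ Δ-along s∈S g ⟩
          Δ g s                    ∎)

      -- Each edge of the walk translates the base point by an element of `S`, which by `no-flip`
      -- leaves the increment along `s` unchanged.
      Δ-walk : ∀ {s g h} → s ∈ S → Walk g h → Δ h s ≈ Δ g s
      Δ-walk s∈S (here g≈h) = Δ-cong (sym g≈h) refl
      Δ-walk s∈S (step {g} (t , t∈S , h≈g+t) walk) =
        trans (Δ-walk s∈S walk) (trans (Δ-cong h≈g+t refl) (no-flip s∈S t∈S g))

      module _ (connected : Connected) where

        -- Induction on the walk, splitting the difference at its second vertex `z`. The start `x`
        -- is arbitrary because it moves along the walk; the conclusion needs only `x = 0#`.
        uniform : ∀ {x y} → Walk x y → ∀ g → to (g + y) - to (g + x) ≈ to y - to x
        uniform {x} {y} (here x≈y) g = begin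
          to (g + y) - to (g + x)  ≈⟨ x≈y⇒x∙y⁻¹≈ε (to-cong (+-congˡ (sym x≈y))) ⟩
          0#                       ≈⟨ x≈y⇒x∙y⁻¹≈ε (to-cong (sym x≈y)) ⟨
          to y - to x              ∎
        uniform {x} {y} (step {h = z} (s , s∈S , z≈x+s) walk) g = begin
          to (g + y) - to (g + x)
            ≈⟨ [x-y]+[y+z]≈x+z _ (to (g + z)) _ ⟨
          (to (g + y) - to (g + z)) + (to (g + z) - to (g + x))
            ≈⟨ +-cong (uniform walk g) (+-congʳ (to-cong (trans (+-congˡ z≈x+s) (sym (assoc g x s))))) ⟩
          (to y - to z) + Δ (g + x) s
            -- A second walk, from `x` to `g + x`, carries the increment along the first edge back
            -- to the base point `x`.
            ≈⟨ +-congˡ (Δ-walk s∈S (connected x (g + x))) ⟩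
          (to y - to z) + Δ x s
            ≈⟨ +-congˡ (+-congʳ (to-cong z≈x+s)) ⟨
          (to y - to z) + (to z - to x)
            ≈⟨ [x-y]+[y+z]≈x+z (to y) (to z) (- to x) ⟩
          to y - to x
            ∎

        affine : Affine G G bijection
        affine = uniform⇒affine G bijection λ g x →
          trans (+-congˡ (-‿cong (to-cong (sym (identityʳ g))))) (uniform (connected 0# x) g)

  index≤2⇒stronglyCCA : Connected →
    (∀ s → s ∈ S → HasOrder s 4 → Index≤ ⟨ T (2 · s) ⟩ 2) → StronglyCCA
  index≤2⇒stronglyCCA connected index≤2 Φ permuting = Straightening.affine Φ permuting index≤2 connected

theorem1p6 : {c ℓ p : Level} → ExcludedMiddle (c ⊔ ℓ ⊔ p) →
    (G : AbelianGroup c ℓ) (S : Pred (AbelianGroup.Carrier G) p) →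
    S Respects (AbelianGroup._≈_ G) →
    GroupNotions.Symmetric G S →
    Cayley.Connected G S →
    let open GroupNotions G
        open Cayley G S
        Condition3 = ∀ s → s ∈ S → HasOrder s 4 → Index≤ ⟨ T (2 · s) ⟩ 2
    in (CCA ⇔ StronglyCCA) × (StronglyCCA ⇔ Condition3)
theorem1p6 em G S _ symmetric connected =
  -- The three implications form the cycle (1), (3), (2), (1), from which both equivalences are
  -- composed.
  mk⇔ (3⇒2 ∘ 1⇒3) 2⇒1 , mk⇔ (1⇒3 ∘ 2⇒1) 3⇒2
  where
  1⇒3 = CCA⇒index≤2 em G S symmetric
  2⇒1 = stronglyCCA⇒CCA em G S symmetric
  3⇒2 = index≤2⇒stronglyCCA em G S symmetric connected
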